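{- Let $n \ge 1$ and let $T_1=([n], E_1)$ and $T_2=([n], E_2)$ be two tournaments on the same vertex set $[n]$. Then there is a vertex $\nu \in [n]$ such that $\nu \Rightarrow j$ for every $j \in [n]$; that is, for every $j\in[n]$ at least one of the following holds: $\nu = j$, or $(\nu,j)\in E_1$, or $(\nu,j)\in E_2$, or there exists $k\in[n]$ with $(\nu,k)\in E_1$ and $(k,j)\in E_2$.
   Context: $[n]=\{1,\dots,n\}$. A tournament $T=([n],E)$ is a directed graph without loops on vertex set $[n]$ such that for every two distinct vertices $i,j$ exactly one of $(i,j)$, $(j,i)$ belongs to $E$. The tournaments $T_1$ and $T_2$ are arbitrary and need not be related. For $i,j\in[n]$, the relation $i\Rightarrow j$ (with respect to the ordered pair $(T_1,T_2)$) means: $i=j$, or $(i,j)\in E_1$, or $(i,j)\in E_2$, or there exists $k$ such that $(i,k)\in E_1$ and $(k,j)\in E_2$. -}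

module Defs where

open import Level using (0ℓ)
open import Data.Nat using (ℕ)
open import Data.Fin using (Fin)
open import Data.Product using (_×_; ∃-syntax)
open import Data.Sum using (_⊎_)
open import Relation.Binary using (Rel)
open import Relation.Binary.PropositionalEquality using (_≡_; _≢_)
open import Relation.Nullary using (¬_)

-- The field `exactlyOne` (with `loopless` and decidable equality on Fin n)
-- makes E decidable, so decidability is not assumed separately.
record Tournament (n : ℕ) : Set₁ where
  field
    E          : Rel (Fin n) 0ℓ
    loopless   : ∀ i → ¬ E i i
    exactlyOne : ∀ i j → i ≢ j → (E i j × ¬ E j i) ⊎ (¬ E i j × E j i)

open Tournament public

infix 4 ⟨_,_⟩_⇒_

⟨_,_⟩_⇒_ : ∀ {n} → Tournament n → Tournament n → Rel (Fin n) 0ℓ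
⟨ T₁ , T₂ ⟩ i ⇒ j =
  i ≡ j ⊎ E T₁ i j ⊎ E T₂ i j ⊎ (∃[ k ] (E T₁ i k × E T₂ k j))

{-# OPTIONS --safe #-}

-- If ν ⇏ j, then ν and all its T₁-out-neighbours are T₂-out-neighbours of j.
-- Without a ν as desired, choosing such a j for each vertex and iterating the
-- choice gives a closed walk g₀, …, gₘ = g₀. Among pairs of positions (t, s), the
-- inclusion makes #{E₁ gₜ gₛ} < #{E₂ gₜ₊₁ gₛ} = #{E₂ gₜ gₛ}. But in any tournament
-- twice this count is the number of (t, s) with gₜ ≢ gₛ, so the two counts agree.
module Submission where

open import Data.Fin using (Fin; zero; suc; toℕ; _≟_)
open import Data.Fin.Properties using (any?; all?; ¬∀⟶∃¬; pigeonhole)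
open import Data.Nat using (ℕ; zero; suc; _+_; _≤_; _<_; _≥_; z≤n)
open import Data.Nat.GeneralisedArithmetic using (fold)
open import Data.Nat.Properties using
  (+-0-commutativeMonoid; +-comm; +-assoc; +-cancelʳ-≡; +-mono-≤; +-mono-<;
   +-mono-<-≤; +-mono-≤-<; ≤-refl; <⇒≤; <-irrefl; m≤n⇒∃[o]m+o≡n; n<1+n; module ≤-Reasoning)
open import Data.Product using (_,_; proj₁; proj₂; ∃-syntax)
open import Data.Sum using (inj₁; inj₂)
open import Data.Bool using (if_then_else_)
open import Function using (_∘_)
open import Relation.Binary using (Decidable)
open import Relation.Binary.PropositionalEquality
open import Relation.Nullary using (Dec; yes; no; does; ¬_; ¬?; contradiction; _×-dec_; _⊎-dec_)
open import Defs

open import Algebra.Properties.CommutativeMonoid.Sum +-0-commutativeMonoid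
  using (sum; sum-cong-≋; ∑-distrib-+; ∑-comm)

sum-mono-≤ : ∀ {n} {u v : Fin n → ℕ} → (∀ i → u i ≤ v i) → sum u ≤ sum v
sum-mono-≤ {zero}  u≤v = z≤n
sum-mono-≤ {suc n} u≤v = +-mono-≤ (u≤v zero) (sum-mono-≤ (u≤v ∘ suc))

sum-mono-< : ∀ {n} {u v : Fin n → ℕ} → (∀ i → u i ≤ v i) →
             ∀ i → u i < v i → sum u < sum v
sum-mono-< u≤v zero    u<v = +-mono-<-≤ u<v (sum-mono-≤ (u≤v ∘ suc))
sum-mono-< u≤v (suc i) u<v = +-mono-≤-< (u≤v zero) (sum-mono-< (u≤v ∘ suc) i u<v)

-- Both sides are `h 0 + … + h m`, split off at opposite ends.
sum-shift : ∀ m (h : ℕ → ℕ) →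
            sum {m} (h ∘ suc ∘ toℕ) + h 0 ≡ sum {m} (h ∘ toℕ) + h m
sum-shift zero    h = refl
sum-shift (suc m) h = begin
  h 1 + S″ + h 0         ≡⟨ cong (_+ h 0) (+-comm (h 1) S″) ⟩
  S″ + h 1 + h 0         ≡⟨ cong (_+ h 0) (sum-shift m (h ∘ suc)) ⟩
  S′ + h (suc m) + h 0   ≡⟨ +-comm (S′ + h (suc m)) (h 0) ⟩
  h 0 + (S′ + h (suc m)) ≡⟨ +-assoc (h 0) S′ (h (suc m)) ⟨
  h 0 + S′ + h (suc m)   ∎
  where
  open ≡-Reasoning
  S′ = sum {m} (h ∘ suc ∘ toℕ)
  S″ = sum {m} (λ t → h (suc (suc (toℕ t))))

sum-cycle : ∀ m (h : ℕ → ℕ) → h m ≡ h 0 →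
            sum {m} (h ∘ suc ∘ toℕ) ≡ sum {m} (h ∘ toℕ)
sum-cycle m h hm≡h0 = +-cancelʳ-≡ (h 0) _ _
  (trans (sum-shift m h) (cong (sum {m} (h ∘ toℕ) +_) hm≡h0))

𝟙 : ∀ {P : Set} → Dec P → ℕ
𝟙 P? = if does P? then 1 else 0

𝟙-mono-≤ : ∀ {P Q : Set} (P? : Dec P) (Q? : Dec Q) → (P → Q) → 𝟙 P? ≤ 𝟙 Q?
𝟙-mono-≤ (no _)  _       _   = z≤n
𝟙-mono-≤ (yes _) (yes _) _   = ≤-refl
𝟙-mono-≤ (yes p) (no ¬q) P⇒Q = contradiction (P⇒Q p) ¬q

𝟙-mono-< : ∀ {P Q : Set} (P? : Dec P) (Q? : Dec Q) → ¬ P → Q → 𝟙 P? < 𝟙 Q?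
𝟙-mono-< (no _)  (yes _) _  _ = ≤-refl
𝟙-mono-< (yes p) _       ¬p _ = contradiction p ¬p
𝟙-mono-< _       (no ¬q) _  q = contradiction q ¬q

module _ {n} (T : Tournament n) where

  E? : Decidable (E T)
  E? i j with i ≟ j
  ... | yes refl = no (loopless T i)
  ... | no i≢j with exactlyOne T i j i≢j
  ...   | inj₁ (e , _)  = yes e
  ...   | inj₂ (¬e , _) = no ¬e

  ¬E⇒E˘ : ∀ {i j} → i ≢ j → ¬ E T i j → E T j i
  ¬E⇒E˘ {i} {j} i≢j ¬e with exactlyOne T i j i≢j
  ... | inj₁ (e , _)  = contradiction e ¬e
  ... | inj₂ (_ , e˘) = e˘

  E-asym : ∀ {i j} → E T i j → ¬ E T j i
  E-asym {i} {j} e with exactlyOne T i j (λ { refl → loopless T i e })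
  ... | inj₁ (_ , ¬e˘) = ¬e˘
  ... | inj₂ (¬e , _)  = contradiction e ¬e

  -- Off the diagonal exactly one orientation is present; on it `loopless` excludes both.
  𝟙E+𝟙E˘ : ∀ i j → 𝟙 (E? i j) + 𝟙 (E? j i) ≡ 𝟙 (¬? (i ≟ j))
  𝟙E+𝟙E˘ i j with i ≟ j | E? i j | E? j i
  ... | yes refl | yes e | _      = contradiction e (loopless T i)
  ... | yes refl | no _  | yes e  = contradiction e (loopless T i)
  ... | yes refl | no _  | no _   = refl
  ... | no i≢j   | yes e | yes e˘ = contradiction e˘ (E-asym e)
  ... | no i≢j   | yes e | no _   = refl
  ... | no i≢j   | no _  | yes _  = refl
  ... | no i≢j   | no ¬e | no ¬e˘ = contradiction (¬E⇒E˘ i≢j ¬e) ¬e˘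

  -- Counting positions instead of vertices weights each arc by multiplicity, as `p` may repeat
  -- vertices.
  edges : ∀ {m} → (Fin m → Fin n) → ℕ
  edges p = sum λ t → sum λ s → 𝟙 (E? (p t) (p s))

  -- Exchanging the two sums reverses all arcs in the second copy, so each pair `t`, `s` contributes
  -- both orientations. The right side does not mention `T`, which is what allows two tournaments to
  -- be compared.
  edges+edges : ∀ {m} (p : Fin m → Fin n) →
                edges p + edges p ≡ sum λ t → sum λ s → 𝟙 (¬? (p t ≟ p s))
  edges+edges {m} p = begin
    edges p + edges p
      ≡⟨ cong (edges p +_) (∑-comm (λ t s → 𝟙 (E? (p t) (p s)))) ⟩
    sum (λ t → sum (λ s → 𝟙 (E? (p t) (p s)))) + sum (λ t → sum (λ s → 𝟙 (E? (p s) (p t))))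
      ≡⟨ ∑-distrib-+ (λ t → sum λ s → 𝟙 (E? (p t) (p s))) _ ⟨
    sum (λ t → sum (λ s → 𝟙 (E? (p t) (p s))) + sum (λ s → 𝟙 (E? (p s) (p t))))
      ≡⟨ sum-cong-≋ (λ t → trans (sym (∑-distrib-+ (λ s → 𝟙 (E? (p t) (p s))) _))
                                 (sum-cong-≋ (λ s → 𝟙E+𝟙E˘ (p t) (p s)))) ⟩
    sum (λ t → sum (λ s → 𝟙 (¬? (p t ≟ p s)))) ∎
    where open ≡-Reasoning

module _ {n} (T₁ T₂ : Tournament n) where

  infix 4 _⇒?_
  _⇒?_ : Decidable (⟨ T₁ , T₂ ⟩_⇒_)
  i ⇒? j = i ≟ j ⊎-dec E? T₁ i j ⊎-dec E? T₂ i j ⊎-dec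
           any? (λ k → E? T₁ i k ×-dec E? T₂ k j)

  ⇏⇒E₂˘ : ∀ {i j} → ¬ (⟨ T₁ , T₂ ⟩ i ⇒ j) → E T₂ j i
  ⇏⇒E₂˘ i⇏j = ¬E⇒E˘ T₂ (i⇏j ∘ inj₁) (i⇏j ∘ inj₂ ∘ inj₂ ∘ inj₁)

  -- If `k` were `j`, the arc in `T₁` would already give `i ⇒ j`; if `T₂` had the arc from `k` to
  -- `j`, the two-step path through `k` would.
  ⇏⇒E₁⊆E₂ : ∀ {i j k} → ¬ (⟨ T₁ , T₂ ⟩ i ⇒ j) → E T₁ i k → E T₂ j k
  ⇏⇒E₁⊆E₂ i⇏j e = ¬E⇒E˘ T₂ (λ { refl → i⇏j (inj₂ (inj₁ e)) })
                           (λ e′ → i⇏j (inj₂ (inj₂ (inj₂ (_ , e , e′)))))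

  no-closed-⇏-walk : (g : ℕ → Fin n) → (∀ t → ¬ (⟨ T₁ , T₂ ⟩ g t ⇒ g (suc t))) →
                     ∀ m → g (suc m) ≢ g 0
  no-closed-⇏-walk g g⇏ m closed = <-irrefl 2e₁≡2e₂ (+-mono-< e₁<e₂ e₁<e₂)
    where
    p : Fin (suc m) → Fin n
    p = g ∘ toℕ

    2e₁≡2e₂ : edges T₁ p + edges T₁ p ≡ edges T₂ p + edges T₂ p
    2e₁≡2e₂ = trans (edges+edges T₁ p) (sym (edges+edges T₂ p))

    row₂ : ℕ → ℕ
    row₂ t = sum λ s → 𝟙 (E? T₂ (g t) (p s))

    row-< : ∀ t → sum (λ s → 𝟙 (E? T₁ (p t) (p s))) < row₂ (suc (toℕ t))
    -- The strict gain is in column `t`: `T₁` has no loop at `p t`, while `T₂` has the arc from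
    -- `g (suc t)` back to `g t`.
    row-< t = sum-mono-<
      (λ s → 𝟙-mono-≤ (E? T₁ (p t) (p s)) (E? T₂ _ _) (⇏⇒E₁⊆E₂ (g⇏ (toℕ t)))) t
      (𝟙-mono-< (E? T₁ (p t) (p t)) (E? T₂ _ _) (loopless T₁ (p t)) (⇏⇒E₂˘ (g⇏ (toℕ t))))

    e₁<e₂ : edges T₁ p < edges T₂ p
    e₁<e₂ = begin-strict
      -- Row `zero` exists because the closed walk has `suc m` steps, hence at least one.
      edges T₁ p                     <⟨ sum-mono-< (<⇒≤ ∘ row-<) zero (row-< zero) ⟩
      -- Only the row index is rotated; the columns stay fixed.
      sum (row₂ ∘ suc ∘ toℕ {suc m}) ≡⟨ sum-cycle (suc m) row₂
                                        (cong (λ v → sum λ s → 𝟙 (E? T₂ v (p s))) closed) ⟩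
      edges T₂ p                     ∎
      where
      open ≤-Reasoning

iterate-periodic : ∀ {n} (f : Fin n → Fin n) (x : Fin n) →
                   ∃[ i ] ∃[ m ] fold x f (suc m + i) ≡ fold x f i
iterate-periodic {n} f x
  -- Two of the first `suc n` iterates coincide, at `i < j`; then `m` is `j - i - 1`.
  with i , j , i<j , eq ← pigeonhole (n<1+n n) (fold x f ∘ toℕ)
  with m , 1+i+m≡j ← m≤n⇒∃[o]m+o≡n i<j
  = toℕ i , m , trans (cong (fold x f) (trans (cong suc (+-comm m (toℕ i))) 1+i+m≡j)) (sym eq)

theorem1 : (n : ℕ) → n ≥ 1 → (T₁ T₂ : Tournament n) →
    ∃[ ν ] (∀ (j : Fin n) → ⟨ T₁ , T₂ ⟩ ν ⇒ j)
theorem1 (suc n) _ T₁ T₂ with any? (λ ν → all? (_⇒?_ T₁ T₂ ν))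
... | yes king = king
... | no ¬king = contradiction closed (no-closed-⇏-walk T₁ T₂ g (λ t → proj₂ (bad (g t))) m)
  where
  bad : ∀ ν → ∃[ j ] ¬ (⟨ T₁ , T₂ ⟩ ν ⇒ j)
  bad ν = ¬∀⟶∃¬ _ _ (_⇒?_ T₁ T₂ ν) (λ ν⇒ → ¬king (ν , ν⇒))

  f : Fin (suc n) → Fin (suc n)
  f = proj₁ ∘ bad

  periodic = iterate-periodic f zero
  i = proj₁ periodic
  m = proj₁ (proj₂ periodic)
  closed = proj₂ (proj₂ periodic)

  g : ℕ → Fin (suc n)
  -- Starting at `i` skips the part before the cycle. With `t` as the left summand, `g (suc t)`
  -- reduces to `f (g t)`.
  g t = fold zero f (t + i)
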